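{- Let $D$ be a domain presented by a language $L$ with a computable numbering of its systems, such that $L$ contains, for each $b\in\{0,1\}$, a system of constant behaviour $b$. There is a $\nu$-index $\delta$, depending only on $L$ (and the numbering $\nu$ of $L^{+}$), such that the following hold. (1) For every $X\subseteq\mathbb{N}$ and every partial $X$-computable $\alpha$, the domain $D^{+}_\alpha$ carries the full trichotomy at $\delta$: $\nu(\delta)\in\mathbf{M}_{D^{+}_\alpha}\iff\alpha(\delta)\!\downarrow=1$; exactly one of (i) $\alpha(\delta)\!\downarrow=1$, (ii) $\alpha(\delta)\!\downarrow\ne1$, (iii) $\alpha(\delta)\!\uparrow$ holds; $\alpha$ is not simultaneously total, exhaustive and sound on $D^{+}_\alpha$; and the three failure modes are exactly (i)–(iii), with (i) refuting soundness, (ii) refuting exhaustiveness and (iii) refuting totality. (2) In particular, if $\alpha=v$ is total, case (iii) is excluded and $v$ is not both exhaustive and sound on $D^{+}_v$. (3) No such domain $D$ that is ask-closed for a correct total adjudicator of itself is decidable.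
   Context: A domain $D$ consists of distinctions (here: the systems of a language $L$, numbered by natural numbers) with a manifestation predicate $\mathbf{M}_D$; a system of constant behaviour $1$ (mark) manifests and one of constant behaviour $0$ (void) does not. $D$ is decidable if its manifestation problem $\{p\in D: p\in\mathbf{M}_D\}$ is decidable. A partial function $\alpha$ on $\mathbb{N}$ is used as an adjudicator: it annuls $p$ if $\alpha(p)\!\downarrow=1$, exempts $p$ if $\alpha(p)\!\downarrow\neq1$, and is silent on $p$ if $\alpha(p)\!\uparrow$. On a domain it is total if silent on no distinction of the domain; exhaustive if it annuls every distinction of the domain; sound if it annuls no manifesting distinction of the domain. A total adjudicator is correct for a domain if it annuls exactly the non-manifesting distinctions of the domain. Ask-extension. Let $L^{+}$ be the language obtained by adjoining to $L$ a single nullary gate $\mathrm{ask}$, as a syntactic symbol. $L^{+}$ is a decidable set of finite syntactic objects; fix once and for all a computable numbering $\nu:\mathbb{N}\to L^{+}$ of it, extending that of $L$ and independent of any semantics. For a partial function $\alpha$ on $\mathbb{N}$, the ask-extension $D^{+}_\alpha$ is the domain whose systems are those of $L^{+}$, evaluated as in $L$ except that in the system $\nu(p)$ every occurrence of $\mathrm{ask}$ evaluates to the mark if $\alpha(p)\!\downarrow=1$, to the void if $\alpha(p)\!\downarrow\neq1$, and diverges if $\alpha(p)\!\uparrow$ (a system whose evaluation diverges does not manifest). The distinctions of $D^{+}_\alpha$ are referred to by their $\nu$-indices $p$, and $\alpha$ acts on $D^{+}_\alpha$ through these indices. $L^{+}$ contains in particular the system that evaluates $\mathrm{ask}$ and then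 behaves as the constant it names. $D$ is ask-closed for $\alpha$ if $D^{+}_\alpha\subseteq D$ up to a computable translation $t$ respecting both manifestation and verdicts, i.e. $\nu(p)\in\mathbf{M}_{D^{+}_\alpha}\iff t(p)\in\mathbf{M}_D$ and $\alpha(t(p))\simeq\alpha(p)$ for all $p$ (where $t(p)$ is a distinction of $D$, and $\simeq$ means both sides are undefined or both are defined and equal). -}

module Defs where

open import Level using (0ℓ)
open import Data.Bool using (Bool; true; false; if_then_else_)
open import Data.Fin using (Fin; zero; suc)
open import Data.Maybe using (Maybe; just; nothing; maybe)
open import Data.Nat using (ℕ; zero; suc; _+_; _*_; _^_; _<_)
open import Data.Nat.Properties using (suc-injective)
open import Data.Product using (∃; _×_; _,_)
open import Data.Sum using (_⊎_; inj₁; inj₂)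
open import Data.Unit using (⊤)
open import Data.Vec using (Vec; []; _∷_; lookup)
open import Function using (_∘_)
open import Function.Bundles using (_⇔_)
open import Function.Definitions using (Injective)
open import Relation.Binary.PropositionalEquality
  using (_≡_; _≢_; refl; sym; trans; cong)
open import Relation.Nullary using (¬_; contradiction)
open import Relation.Unary using (Pred; ∅)

------------------------------------------------------------------------
-- Partial values and partial functions

-- A partial value is given by its graph, so definedness need not be
-- decidable.

record Partial (A : Set) : Set₁ where
  infix 4 _↓=_
  field
    _↓=_   : Pred A 0ℓ
    unique : ∀ {x y} → _↓=_ x → _↓=_ y → x ≡ y

open Partial public using (_↓=_)

infix 4 _↑ _≃_
infixr 0 _⇀_

_↑ : {A : Set} → Partial A → Set
a ↑ = ¬ ∃ λ x → a ↓= x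

_≃_ : {A : Set} → Partial A → Partial A → Set
a ≃ b = (a ↑ × b ↑) ⊎ ∃ λ x → (a ↓= x) × (b ↓= x)

_⇀_ : Set → Set → Set₁
A ⇀ B = A → Partial B

------------------------------------------------------------------------
-- Relative computability: partial recursive functions with an oracle

data Program : ℕ → Set where
  zer : ∀ {n} → Program n
  suc : Program 1
  orc : Program 1
  prj : ∀ {n} → Fin n → Program n
  cmp : ∀ {m n} → Program m → Vec (Program n) m → Program n
  rec : ∀ {n} → Program n → Program (2 + n) → Program (1 + n)
  min : ∀ {n} → Program (1 + n) → Program n

infix 3 _⊢_[_]⇓_

-- X ⊢ f [ xs ]⇓ y: with oracle the characteristic function of X, the
-- program f on arguments xs halts with value y.  In rec f g the step g
-- receives the counter, then the previous value, then the parameters.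

data _⊢_[_]⇓_ (X : Pred ℕ 0ℓ) : ∀ {n} → Program n → Vec ℕ n → ℕ → Set where
  zer-⇓   : ∀ {n} {xs : Vec ℕ n} → X ⊢ zer [ xs ]⇓ 0
  suc-⇓   : ∀ {x} → X ⊢ suc [ x ∷ [] ]⇓ suc x
  orc-in  : ∀ {x} → X x → X ⊢ orc [ x ∷ [] ]⇓ 1
  orc-out : ∀ {x} → ¬ X x → X ⊢ orc [ x ∷ [] ]⇓ 0
  prj-⇓   : ∀ {n} {i : Fin n} {xs} → X ⊢ prj i [ xs ]⇓ lookup xs i
  cmp-⇓   : ∀ {m n} {f : Program m} {gs : Vec (Program n) m} {xs ys z} →
            (∀ i → X ⊢ lookup gs i [ xs ]⇓ lookup ys i) →
            X ⊢ f [ ys ]⇓ z →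
            X ⊢ cmp f gs [ xs ]⇓ z
  rec-0   : ∀ {n} {f : Program n} {g xs z} →
            X ⊢ f [ xs ]⇓ z →
            X ⊢ rec f g [ 0 ∷ xs ]⇓ z
  rec-s   : ∀ {n} {f : Program n} {g xs k y z} →
            X ⊢ rec f g [ k ∷ xs ]⇓ y →
            X ⊢ g [ k ∷ y ∷ xs ]⇓ z →
            X ⊢ rec f g [ suc k ∷ xs ]⇓ z
  min-⇓   : ∀ {n} {f : Program (1 + n)} {xs y} →
            (∀ {k} → k < y → ∃ λ v → X ⊢ f [ k ∷ xs ]⇓ suc v) →
            X ⊢ f [ y ∷ xs ]⇓ 0 →
            X ⊢ min f [ xs ]⇓ y

_ComputableIn_ : (ℕ ⇀ ℕ) → Pred ℕ 0ℓ → Set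
α ComputableIn X = ∃ λ e → ∀ p y → (α p ↓= y) ⇔ (X ⊢ e [ p ∷ [] ]⇓ y)

Computable : (ℕ → ℕ) → Set
Computable f = ∃ λ e → ∀ p → ∅ ⊢ e [ p ∷ [] ]⇓ f p

DecidableSet : Pred ℕ 0ℓ → Set
DecidableSet S = ∃ λ (χ : ℕ → Bool) →
  Computable (λ p → if χ p then 1 else 0) × (∀ p → S p ⇔ χ p ≡ true)

------------------------------------------------------------------------
-- Domains and adjudicators

record Domain : Set₁ where
  field
    Distinction : Pred ℕ 0ℓ
    Manifests   : Pred ℕ 0ℓ
    manifests⊆  : ∀ {p} → Manifests p → Distinction p

open Domain public using (Distinction; Manifests)

DecidableDomain : Domain → Set
DecidableDomain D = DecidableSet (Manifests D)

Annuls Exempts Silent : (ℕ ⇀ ℕ) → ℕ → Set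
Annuls  α p = α p ↓= 1
Exempts α p = ∃ λ y → (α p ↓= y) × y ≢ 1
Silent  α p = α p ↑

Total Exhaustive Sound Correct : (ℕ ⇀ ℕ) → Domain → Set
Total      α D = ∀ p → Distinction D p → ¬ Silent α p
Exhaustive α D = ∀ p → Distinction D p → Annuls α p
Sound      α D = ∀ p → Distinction D p → Manifests D p → ¬ Annuls α p
Correct    α D = ∀ p → Distinction D p → Annuls α p ⇔ (¬ Manifests D p)

ExactlyOne : Set → Set → Set → Set
ExactlyOne A B C = (A ⊎ B ⊎ C) × ¬ (A × B) × ¬ (A × C) × ¬ (B × C)

------------------------------------------------------------------------
-- Syntax

-- Gates are named by symbols in ℕ.  The last field says that the set of
-- symbols is decidable and arities are computable, so that the closed
-- terms over the signature form a decidable set of finite objects.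

record Signature : Set₁ where
  field
    Gate      : Set
    arity     : Gate → ℕ
    symbol    : Gate → ℕ
    injective : Injective _≡_ _≡_ symbol
    effective : ∃ λ (a : ℕ → ℕ) → Computable a
              × (∀ g → a (symbol g) ≡ suc (arity g))
              × (∀ n → a n ≢ 0 → ∃ λ g → symbol g ≡ n)

open Signature public using (Gate; arity; symbol)

data Term (S : Signature) : Set where
  node : (g : Gate S) → Vec (Term S) (arity S g) → Term S

-- An injective coding of terms by natural numbers: (x , y) is coded by
-- 2ˣ(2y + 1) and the empty sequence by 0.

pair : ℕ → ℕ → ℕ
pair x y = 2 ^ x * suc (2 * y)

module _ {S : Signature} where
  code  : Term S → ℕ
  codes : ∀ {n} → Vec (Term S) n → ℕ
  code (node g ts) = pair (symbol S g) (codes ts)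
  codes []         = 0
  codes (t ∷ ts)   = pair (code t) (codes ts)

module _ {S : Signature} {B : Set}
         (⟦_⟧ : (g : Gate S) → Vec (Partial B) (arity S g) → Partial B) where
  eval  : Term S → Partial B
  evals : ∀ {n} → Vec (Term S) n → Vec (Partial B) n
  eval (node g ts) = ⟦ g ⟧ (evals ts)
  evals []         = []
  evals (t ∷ ts)   = eval t ∷ evals ts

-- nothing is the gate ask.

withAsk : Signature → Signature
withAsk S = record
  { Gate      = Maybe (Gate S)
  ; arity     = maybe (arity S) 0
  ; symbol    = maybe (suc ∘ symbol S) 0
  ; injective = λ {g} {h} → symbol-injective g h
  ; effective = let (a , (e , e-⇓) , a-arity , a-symbol) = Signature.effective S in
      shift a , (shiftProgram e , shift-⇓ a e e-⇓) ,
      (λ where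
        (just g) → a-arity g
        nothing  → refl) ,
      (λ where
        zero    _  → nothing , refl
        (suc n) nz → let (g , eq) = a-symbol n nz in just g , cong suc eq)
  }
  where
  symbol-injective : ∀ g h → maybe (suc ∘ symbol S) 0 g ≡ maybe (suc ∘ symbol S) 0 h →
                     g ≡ h
  symbol-injective (just g) (just h) eq = cong just (Signature.injective S (suc-injective eq))
  symbol-injective nothing  nothing  _  = refl
  symbol-injective (just _) nothing  ()
  symbol-injective nothing  (just _) ()

  shift : (ℕ → ℕ) → ℕ → ℕ
  shift a zero    = 1
  shift a (suc n) = a n

  shiftProgram : Program 1 → Program 1
  shiftProgram e = rec (cmp suc (zer ∷ [])) (cmp e (prj zero ∷ []))

  single : ∀ {n} {g : Program n} {xs y} → ∅ ⊢ g [ xs ]⇓ y →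
           ∀ i → ∅ ⊢ lookup (g ∷ []) i [ xs ]⇓ lookup (y ∷ []) i
  single d zero = d

  shift-⇓ : ∀ a e → (∀ p → ∅ ⊢ e [ p ∷ [] ]⇓ a p) →
            ∀ p → ∅ ⊢ shiftProgram e [ p ∷ [] ]⇓ shift a p
  shift-⇓ a e h zero    = rec-0 (cmp-⇓ {ys = 0 ∷ []} (single zer-⇓) suc-⇓)
  shift-⇓ a e h (suc p) =
    rec-s (shift-⇓ a e h p) (cmp-⇓ {ys = p ∷ []} (single prj-⇓) (h p))

ask : ∀ {S} → Term (withAsk S)
ask = node nothing []

module _ {S : Signature} where
  embed  : Term S → Term (withAsk S)
  embeds : ∀ {n} → Vec (Term S) n → Vec (Term (withAsk S)) n
  embed (node g ts) = node (just g) (embeds ts)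
  embeds []         = []
  embeds (t ∷ ts)   = embed t ∷ embeds ts

------------------------------------------------------------------------
-- Languages and their numberings

-- Gates act on partial behaviours, so they may be strict or lazy in
-- their arguments.  constant true is the mark, constant false the void.

record Language : Set₁ where
  field
    signature : Signature
    Behaviour : Set
    constant  : Bool → Behaviour
    ⟦_⟧       : (g : Gate signature) →
                Vec (Partial Behaviour) (arity signature g) → Partial Behaviour

  System System⁺ : Set
  System  = Term signature
  System⁺ = Term (withAsk signature)

  evaluate : System → Partial Behaviour
  evaluate = eval ⟦_⟧

  -- Evaluation when every occurrence of ask evaluates to a.
  evaluate⁺ : Partial Behaviour → System⁺ → Partial Behaviour
  evaluate⁺ a = eval λ where
    (just g) → ⟦ g ⟧
    nothing  → λ _ → a

  -- The result of evaluating ask in the system ν(p).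
  verdict : (ℕ ⇀ ℕ) → ℕ → Partial Behaviour
  verdict α p = record
    { _↓=_   = λ β → (Annuls α p × β ≡ constant true)
                   ⊎ (Exempts α p × β ≡ constant false)
    ; unique = λ where
        (inj₁ (_ , eq)) (inj₁ (_ , eq′)) → trans eq (sym eq′)
        (inj₂ (_ , eq)) (inj₂ (_ , eq′)) → trans eq (sym eq′)
        (inj₁ (d , _)) (inj₂ ((_ , d′ , y≢1) , _)) →
          contradiction (Partial.unique (α p) d′ d) y≢1
        (inj₂ ((_ , d′ , y≢1) , _)) (inj₁ (d , _)) →
          contradiction (Partial.unique (α p) d′ d) y≢1
    }

HasConstants : Language → Set
HasConstants L = ∀ b → ∃ λ s → Language.evaluate L s ↓= Language.constant L b

-- Indices in a numbering of L may form a proper (decidable) subset of ℕ.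

record Numbering (L : Language) : Set where
  open Language L
  field
    system     : ℕ → Maybe System
    computable : Computable (maybe (suc ∘ code) 0 ∘ system)
    surjective : ∀ s → ∃ λ p → system p ≡ just s

-- A numbering of L⁺ extends that of L along a computable injection of
-- indices; reindex p = p is extension in the literal sense.

record AskNumbering (L : Language) (N : Numbering L) : Set where
  open Language L
  field
    ν                  : ℕ → System⁺
    computable         : Computable (code ∘ ν)
    surjective         : ∀ s → ∃ λ p → ν p ≡ s
    reindex            : ℕ → ℕ
    reindex-computable : Computable reindex
    reindex-injective  : Injective _≡_ _≡_ reindex
    extends            : ∀ p s → Numbering.system N p ≡ just s →
                         ν (reindex p) ≡ embed s

------------------------------------------------------------------------
-- Domains presented by a language

record Manifestation (L : Language) : Set₁ where
  open Language L
  field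
    Manifest : Pred Behaviour 0ℓ
    mark     : Manifest (constant true)
    void     : ¬ Manifest (constant false)

  -- A diverging system does not manifest.
  Manifesting : Pred (Partial Behaviour) 0ℓ
  Manifesting b = ∃ λ β → (b ↓= β) × Manifest β

module _ {L : Language} (N : Numbering L) (M : Manifestation L) where
  open Language L
  open Manifestation M

  domain : Domain
  domain = record
    { Distinction = λ p → ∃ λ s → Numbering.system N p ≡ just s
    ; Manifests   = λ p → ∃ λ s → Numbering.system N p ≡ just s
                                × Manifesting (evaluate s)
    ; manifests⊆  = λ (s , eq , _) → s , eq
    }

  module _ (N⁺ : AskNumbering L N) where
    open AskNumbering N⁺

    askExtension : (ℕ ⇀ ℕ) → Domain
    askExtension α = record
      { Distinction = λ _ → ⊤
      ; Manifests   = λ p → Manifesting (evaluate⁺ (verdict α p) (ν p))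
      ; manifests⊆  = λ _ → _
      }

    AskClosed : (ℕ ⇀ ℕ) → Set
    AskClosed α = ∃ λ (t : ℕ → ℕ) → Computable t × (∀ p →
        Distinction domain (t p)
      × (Manifests (askExtension α) p ⇔ Manifests domain (t p))
      × α (t p) ≃ α p)

{-# OPTIONS --safe #-}

-- δ is a ν-index of the bare gate ask: whatever α says about δ, the system
-- ν(δ) behaves accordingly, so it manifests exactly when α annuls it.
-- For (3), the verdict-preserving translation carries δ to a distinction
-- t(δ) of D that manifests iff v annuls it, contrary to correctness of v.

module Submission where

open import Defs
open import Axiom.ExcludedMiddle using (ExcludedMiddle)
open import Data.Nat using (ℕ; _≟_)
open import Data.Product using (∃; _×_; _,_)
open import Data.Sum using (_⊎_; inj₁; inj₂)
open import Function.Base using (_∘_)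
open import Function.Bundles using (_⇔_; mk⇔; module Equivalence)
open import Level using (0ℓ)
open import Relation.Binary.PropositionalEquality using (_≡_; refl; sym; subst)
open import Relation.Nullary using (¬_; yes; no; contradiction)
open import Relation.Unary using (Pred)

open Equivalence using (to; from)

-- If both sides are undefined, either premise is absurd; otherwise uniqueness identifies `x` with
-- the common value.
≃-transport : {A : Set} (a b : Partial A) {x : A} → a ≃ b → a ↓= x ⇔ b ↓= x
≃-transport a b (inj₁ (a↑ , b↑)) = mk⇔
  (λ d → contradiction (_ , d) a↑)
  (λ d → contradiction (_ , d) b↑)
≃-transport a b (inj₂ (_ , a↓y , b↓y)) = mk⇔
  (λ d → subst (b ↓=_) (Partial.unique a a↓y d) b↓y)
  (λ d → subst (a ↓=_) (Partial.unique b b↓y d) a↓y)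

module _ (α : ℕ ⇀ ℕ) {p : ℕ} where

  annuls⇒¬exempts : Annuls α p → ¬ Exempts α p
  annuls⇒¬exempts d (_ , d′ , y≢1) = y≢1 (Partial.unique (α p) d′ d)

  -- Excluded middle decides whether `α p` is defined, which is a halting question; comparing a
  -- given value with 1 is decidable.
  verdict-trichotomy : ExcludedMiddle 0ℓ →
                       ExactlyOne (Annuls α p) (Exempts α p) (Silent α p)
  verdict-trichotomy em =
      some
    , (λ (a , e) → annuls⇒¬exempts a e)
    , (λ (a , s) → s (_ , a))
    , (λ ((_ , d , _) , s) → s (_ , d))
    where
    some : Annuls α p ⊎ Exempts α p ⊎ Silent α p
    some with em {P = ∃ λ y → α p ↓= y}
    ... | no  α↑      = inj₂ (inj₂ α↑)
    ... | yes (y , d) with y ≟ 1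
    ...   | yes refl = inj₁ d
    ...   | no  y≢1  = inj₂ (inj₁ (y , d , y≢1))

module _ {L : Language} (M : Manifestation L) where
  open Language L
  open Manifestation M

  -- Annulment yields the mark. The exempt branch yields the void, which does not manifest, and
  -- silence yields no behaviour at all.
  verdict-manifesting : ∀ α p → Manifesting (verdict α p) ⇔ Annuls α p
  verdict-manifesting α p = mk⇔
    (λ where
      (_ , inj₁ (a , _)    , _) → a
      (_ , inj₂ (_ , refl) , m) → contradiction m void)
    (λ a → _ , inj₁ (a , refl) , mark)

  module _ {N : Numbering L} (N⁺ : AskNumbering L N) {δ : ℕ}
           (ν-δ : AskNumbering.ν N⁺ δ ≡ ask) where

    ask-manifests : ∀ α → Manifests (askExtension N M N⁺ α) δ ⇔ Annuls α δ
    ask-manifests α =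
      -- On the literal term `ask`, `evaluate⁺` reduces to `verdict α δ` by computation, so it
      -- suffices to rewrite along `ν-δ`.
      subst (λ s → Manifesting (evaluate⁺ (verdict α δ) s) ⇔ Annuls α δ)
            (sym ν-δ) (verdict-manifesting α δ)

    annuls⇒¬sound : ∀ α → Annuls α δ → ¬ Sound α (askExtension N M N⁺ α)
    annuls⇒¬sound α a sound = sound δ _ (from (ask-manifests α) a) a

    -- Exhaustiveness applies to `δ` itself, and annulling `δ` is what makes it manifest.
    ¬exhaustive×sound : ∀ α → ¬ (Exhaustive α (askExtension N M N⁺ α)
                               × Sound α (askExtension N M N⁺ α))
    ¬exhaustive×sound α (exhaustive , sound) =
      annuls⇒¬sound α (exhaustive δ _) sound

    correct⇒¬askClosed : ∀ v → Correct v (domain N M) → ¬ AskClosed N M N⁺ v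
    correct⇒¬askClosed v correct (t , _ , translates)
      with distinction , manifests , verdicts ← translates δ = ¬m m
      where
      same-verdict : Annuls v (t δ) ⇔ Annuls v δ
      same-verdict = ≃-transport (v (t δ)) (v δ) verdicts

      annuls⇒manifests : Annuls v (t δ) → Manifests (domain N M) (t δ)
      annuls⇒manifests = to manifests ∘ from (ask-manifests v) ∘ to same-verdict

      manifests⇒annuls : Manifests (domain N M) (t δ) → Annuls v (t δ)
      manifests⇒annuls = from same-verdict ∘ to (ask-manifests v) ∘ from manifests

      -- A liar argument, carried out constructively: if `t δ` manifested it would be annulled,
      -- which correctness forbids.
      ¬m : ¬ Manifests (domain N M) (t δ)
      ¬m m = to (correct (t δ) distinction) (manifests⇒annuls m) m

      -- Correctness then turns `¬m` into annulment of `t δ`, and annulment makes `t δ` manifest.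
      m : Manifests (domain N M) (t δ)
      m = annuls⇒manifests (from (correct (t δ) distinction) ¬m)

theorem4p7 :
    ExcludedMiddle 0ℓ →
    (L : Language) (N : Numbering L) → HasConstants L →
    (N⁺ : AskNumbering L N) →
    ∃ λ (δ : ℕ) → (M : Manifestation L) →
      let D = domain N M
          D⁺ = askExtension N M N⁺
      in
      ((X : Pred ℕ 0ℓ) (α : ℕ ⇀ ℕ) → α ComputableIn X →
          (Manifests (D⁺ α) δ ⇔ Annuls α δ)
        × ExactlyOne (Annuls α δ) (Exempts α δ) (Silent α δ)
        × ¬ (Total α (D⁺ α) × Exhaustive α (D⁺ α) × Sound α (D⁺ α))
        × (Annuls α δ → ¬ Sound α (D⁺ α))
        × (Exempts α δ → ¬ Exhaustive α (D⁺ α))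
        × (Silent α δ → ¬ Total α (D⁺ α)))
      × ((X : Pred ℕ 0ℓ) (v : ℕ ⇀ ℕ) → v ComputableIn X → Total v (D⁺ v) →
          ¬ Silent v δ × ¬ (Exhaustive v (D⁺ v) × Sound v (D⁺ v)))
      × ((v : ℕ ⇀ ℕ) → Total v D → Correct v D → AskClosed N M N⁺ v →
          ¬ DecidableDomain D)
-- The index comes from surjectivity of `ν`, before `M` and any adjudicator are introduced, so one
-- `δ` serves them all.
theorem4p7 em L N _ N⁺ with δ , ν-δ ← AskNumbering.surjective N⁺ ask = δ , λ M →
    (λ _ α _ →
        ask-manifests M N⁺ ν-δ α
      , verdict-trichotomy α em
      , (λ (_ , exhaustive×sound) → ¬exhaustive×sound M N⁺ ν-δ α exhaustive×sound)
      , annuls⇒¬sound M N⁺ ν-δ α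
      , (λ e exhaustive → annuls⇒¬exempts α (exhaustive δ _) e)
      , (λ s total → total δ _ s))
  , (λ _ v _ total → total δ _ , ¬exhaustive×sound M N⁺ ν-δ v)
  , (λ v _ correct closed _ → correct⇒¬askClosed M N⁺ ν-δ v correct closed)
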